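{- Let $n\le 4$ be a positive integer. No parallel chip-firing game on any orientation of the complete graph $K_n$ has period $T=2$.
   Context: A directed graph $D=(V,E)$ is a finite set of vertices $V$ with a set $E$ of ordered pairs of vertices; $(u,v)\in E$ is an edge directed from $u$ to $v$, and the out-degree $\deg^+ v$ is the number of edges directed from $v$. An orientation of an undirected graph $G$ is a directed graph on the same vertex set obtained by replacing each edge $\{u,v\}$ of $G$ by exactly one of $(u,v)$, $(v,u)$. A parallel chip-firing game on $D$ starts with a finite nonnegative integer number of chips on each vertex. In each round, simultaneously, every vertex $v$ having at least $\deg^+ v$ chips fires, sending one chip along each of its outgoing edges; all other vertices wait. The game has period $T$ if $T$ is the smallest positive integer for which there is a round $t_0$ such that every vertex has the same number of chips in round $t$ as in round $t+T$ for all $t\ge t_0$. -}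

module Defs where

open import Algebra.Properties.CommutativeMonoid.Sum using (sum)
open import Data.Bool.Base using (Bool; T; if_then_else_; _∧_)
open import Data.Fin.Base using (Fin)
open import Data.Nat.Base using (ℕ; zero; suc; _+_; _∸_; _≤_; _≥_; _≤ᵇ_)
open import Data.Nat.Properties using (+-0-commutativeMonoid)
open import Data.Product.Base using (_×_; ∃-syntax)
open import Data.Sum.Base using (_⊎_)
open import Level using (0ℓ)
open import Relation.Binary.Core using (Rel)
open import Relation.Binary.Definitions using (Symmetric; Irreflexive)
open import Relation.Binary.PropositionalEquality using (_≡_; _≢_; ≢-sym)
open import Relation.Nullary.Negation using (¬_)

record Graph (n : ℕ) : Set₁ where
  field
    Adj    : Rel (Fin n) 0ℓ
    sym    : Symmetric Adj
    irrefl : Irreflexive _≡_ Adj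

K : ∀ n → Graph n
K n = record
  { Adj    = _≢_
  ; sym    = ≢-sym
  ; irrefl = λ u≡v u≢v → u≢v u≡v
  }

-- The edge set is given by its characteristic function on ordered pairs;
-- loops and antiparallel pairs are allowed.
record Digraph (n : ℕ) : Set where
  field
    edge : Fin n → Fin n → Bool

  _⟶_ : Rel (Fin n) 0ℓ
  u ⟶ v = T (edge u v)

record _IsOrientationOf_ {n : ℕ} (D : Digraph n) (G : Graph n) : Set where
  open Digraph D
  open Graph G
  field
    edge⇒adj   : ∀ {u v} → u ⟶ v → Adj u v
    exactlyOne : ∀ {u v} → Adj u v →
                 (u ⟶ v × ¬ (v ⟶ u)) ⊎ (v ⟶ u × ¬ (u ⟶ v))

Config : ℕ → Set
Config n = Fin n → ℕ

count : ∀ {n} → (Fin n → Bool) → ℕ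
count p = sum +-0-commutativeMonoid (λ i → if p i then 1 else 0)

module _ {n : ℕ} (D : Digraph n) where
  open Digraph D

  outDeg : Fin n → ℕ
  outDeg v = count (λ w → edge v w)

  fires : Config n → Fin n → Bool
  fires c v = outDeg v ≤ᵇ c v

  -- The truncated subtraction is exact, since v only loses chips when it
  -- has at least outDeg v of them.
  step : Config n → Config n
  step c v = (c v ∸ (if fires c v then outDeg v else 0))
             + count (λ u → fires c u ∧ edge u v)

  -- chips c t is the position in round t of the game started from c.
  chips : Config n → ℕ → Config n
  chips c zero    = c
  chips c (suc t) = step (chips c t)

  EventuallyRepeats : Config n → ℕ → Set
  EventuallyRepeats c p = ∃[ t₀ ] (∀ t → t ≥ t₀ → ∀ v → chips c t v ≡ chips c (t + p) v)

  HasPeriod : Config n → ℕ → Set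
  HasPeriod c p = p ≥ 1 × EventuallyRepeats c p
                  × (∀ p′ → p′ ≥ 1 → EventuallyRepeats c p′ → p ≤ p′)

{-# OPTIONS --safe #-}
-- In a game of period dividing 2 let x and y be the sets of vertices firing in
-- even and in odd rounds.  Over two rounds every vertex sends as many chips as
-- it receives, and a vertex that fires in one round but not in the next cannot
-- have received its out-degree in the first one.  These constraints no longer
-- mention the number of chips, so for n ≤ 4 an exhaustive search over
-- tournaments, x and y shows that they already force every vertex to send as
-- many chips as it receives in a single round; the game is then constant.
module Submission where

open import Defs
open import Data.Bool.Base using (Bool; true; false; T; not; if_then_else_; _∧_)
open import Data.Bool.Properties using (T?)
open import Data.Empty using (⊥-elim)
open import Data.Fin.Base using (Fin; zero; suc)
open import Data.Fin.Properties using (all?; suc-injective)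
open import Data.Fin.Subset using (Subset; inside; outside)
open import Data.Nat.Base using (ℕ; zero; suc; _+_; _∸_; _≤_; _<_; _≥_; z≤n; s≤s; _≤ᵇ_)
open import Data.Nat.Properties
  using ( _≟_; _<?_; +-assoc; +-comm; +-cancelˡ-≡; +-cancelʳ-≡; +-0-commutativeMonoid
        ; m∸n+n≡m; m≤n+m; ≤-refl; ≤-<-trans; <-irrefl; ≰⇒>; ≤ᵇ⇒≤; ≤⇒≤ᵇ )
open import Data.Nat.Tactic.RingSolver using (solve-∀)
open import Data.Product.Base using (_×_; _,_; ∃-syntax)
open import Data.Sum.Base using (inj₁; inj₂)
open import Data.Vec.Base using ([]; _∷_; lookup; tabulate)
open import Data.Vec.Properties using (lookup∘tabulate)
open import Algebra.Properties.CommutativeMonoid.Sum +-0-commutativeMonoid using (sum-cong-≗)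
open import Function.Base using (_∘_)
open import Relation.Binary.PropositionalEquality
  using (_≡_; _≢_; _≗_; refl; sym; trans; cong; cong₂; subst; subst₂; module ≡-Reasoning)
open import Relation.Nullary.Decidable using (Dec; map′; from-yes; ¬?; _×-dec_; _→-dec_)
open import Relation.Nullary.Negation using (¬_)

private
  variable
    n : ℕ

count-cong : {p q : Fin n → Bool} → p ≗ q → count p ≡ count q
count-cong p≗q = sum-cong-≗ (cong (λ b → if b then 1 else 0) ∘ p≗q)

-- Firing sets and the constraints on them, free of chip counts.

module _ (D : Digraph n) where
  open Digraph D

  sent : (Fin n → Bool) → Fin n → ℕ
  sent x v = if x v then outDeg D v else 0

  received : (Fin n → Bool) → Fin n → ℕ
  received x v = count (λ u → x u ∧ edge u v)

  Steady : (Fin n → Bool) → Set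
  Steady x = ∀ v → sent x v ≡ received x v

  RestsAfter : (x y : Fin n → Bool) → Fin n → Set
  RestsAfter x y v = T (x v) → ¬ T (y v) → received x v < outDeg D v

  Alternates : (x y : Fin n → Bool) → Set
  Alternates x y = ∀ v → sent x v + sent y v ≡ received x v + received y v
                         × RestsAfter x y v × RestsAfter y x v

  restsAfter? : ∀ x y v → Dec (RestsAfter x y v)
  restsAfter? x y v =
    T? (x v) →-dec ¬? (T? (y v)) →-dec received x v <? outDeg D v

  alternates? : ∀ x y → Dec (Alternates x y)
  alternates? x y = all? λ v →
    sent x v + sent y v ≟ received x v + received y v
    ×-dec restsAfter? x y v ×-dec restsAfter? y x v

  steady? : ∀ x → Dec (Steady x)
  steady? x = all? λ v → sent x v ≟ received x v

-- Invariance under pointwise equality.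

module _ {D D′ : Digraph n}
         (D≗D′ : ∀ u v → Digraph.edge D u v ≡ Digraph.edge D′ u v) where

  outDeg-cong : ∀ v → outDeg D v ≡ outDeg D′ v
  outDeg-cong v = count-cong (D≗D′ v)

  module _ {x x′ : Fin n → Bool} (x≗x′ : x ≗ x′) where

    sent-cong : ∀ v → sent D x v ≡ sent D′ x′ v
    sent-cong v = cong₂ (λ b d → if b then d else 0) (x≗x′ v) (outDeg-cong v)

    received-cong : ∀ v → received D x v ≡ received D′ x′ v
    received-cong v = count-cong (λ u → cong₂ _∧_ (x≗x′ u) (D≗D′ u v))

    restsAfter-cong : ∀ {y y′} → y ≗ y′ → ∀ v → RestsAfter D x y v → RestsAfter D′ x′ y′ v
    restsAfter-cong y≗y′ v rests x′v ¬y′v =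
      subst₂ _<_ (received-cong v) (outDeg-cong v)
        (rests (subst T (sym (x≗x′ v)) x′v) (¬y′v ∘ subst T (y≗y′ v)))

  -- Tabulating a Boolean function and looking it up again gives only a pointwise equal function, so
  -- the constraints have to be carried to the finite data of the search, and `Steady` carried back.
  alternates-cong : ∀ {x x′ y y′} → x ≗ x′ → y ≗ y′ → Alternates D x y → Alternates D′ x′ y′
  alternates-cong x≗x′ y≗y′ alt v with alt v
  ... | balance , restˣ , restʸ =
      trans (sym (cong₂ _+_ (sent-cong x≗x′ v) (sent-cong y≗y′ v)))
        (trans balance (cong₂ _+_ (received-cong x≗x′ v) (received-cong y≗y′ v)))
    , restsAfter-cong x≗x′ y≗y′ v restˣ
    , restsAfter-cong y≗y′ x≗x′ v restʸ

  steady-cong : ∀ {x x′} → x ≗ x′ → Steady D x → Steady D′ x′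
  steady-cong x≗x′ st v =
    trans (sym (sent-cong x≗x′ v)) (trans (st v) (received-cong x≗x′ v))

-- Orientations of `K n` as finite data.

-- In r ∷ t, the set r consists of the vertices of t beaten by the new vertex.
data Tournament : ℕ → Set where
  []  : Tournament 0
  _∷_ : Subset n → Tournament n → Tournament (suc n)

beats : Tournament n → Fin n → Fin n → Bool
beats (r ∷ t) zero    zero    = false
beats (r ∷ t) zero    (suc v) = lookup r v
beats (r ∷ t) (suc u) zero    = not (lookup r u)
beats (r ∷ t) (suc u) (suc v) = beats t u v

digraph : Tournament n → Digraph n
digraph t = record { edge = beats t }

module _ {D : Digraph (suc n)} (orient : D IsOrientationOf K (suc n)) where
  open _IsOrientationOf_ orient

  tail : Digraph n
  tail = record { edge = λ u v → Digraph.edge D (suc u) (suc v) }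

  tail-orientation : tail IsOrientationOf K n
  tail-orientation = record
    { edge⇒adj   = λ e → edge⇒adj e ∘ cong suc
    ; exactlyOne = λ u≢v → exactlyOne (u≢v ∘ suc-injective)
    }

module _ {D : Digraph n} (orient : D IsOrientationOf K n) where
  open Digraph D
  open _IsOrientationOf_ orient

  noLoop : ∀ v → edge v v ≡ false
  noLoop v with edge v v in eq
  ... | false = refl
  ... | true  = ⊥-elim (edge⇒adj (subst T (sym eq) _) refl)

  reverse-edge : ∀ {u v} → u ≢ v → edge v u ≡ not (edge u v)
  reverse-edge {u} {v} u≢v with edge u v | edge v u | exactlyOne u≢v
  ... | true  | true  | inj₁ (_ , ¬vu) = ⊥-elim (¬vu _)
  ... | true  | true  | inj₂ (_ , ¬uv) = ⊥-elim (¬uv _)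
  ... | true  | false | _              = refl
  ... | false | true  | _              = refl
  ... | false | false | inj₁ (() , _)
  ... | false | false | inj₂ (() , _)

-- Induction that splits off vertex `zero`: its out-neighbours form the first row, and
-- `reverse-edge` recovers its in-edges as the complement of that row.
orientation⇒tournament : ∀ n (D : Digraph n) → D IsOrientationOf K n →
                         ∃[ t ] (∀ u v → beats t u v ≡ Digraph.edge D u v)
orientation⇒tournament zero    D orient = [] , λ ()
orientation⇒tournament (suc n) D orient
  with t , t≗D ← orientation⇒tournament n (tail orient) (tail-orientation orient)
  = tabulate row ∷ t , λ where
      zero    zero    → sym (noLoop orient zero)
      zero    (suc v) → lookup∘tabulate row v
      (suc u) zero    → trans (cong not (lookup∘tabulate row u))
                              (sym (reverse-edge orient λ ()))
      (suc u) (suc v) → t≗D u v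
  where
  row : Fin n → Bool
  row v = Digraph.edge D zero (suc v)

-- Exhaustive search.

allSubsets? : {P : Subset n → Set} → (∀ p → Dec (P p)) → Dec (∀ p → P p)
allSubsets? {zero}  P? = map′ (λ { p [] → p }) (λ f → f []) (P? [])
allSubsets? {suc n} P? =
  map′ (λ { (f , g) (inside ∷ p) → f p ; (f , g) (outside ∷ p) → g p })
       (λ f → (f ∘ (inside ∷_)) , (f ∘ (outside ∷_)))
       (allSubsets? (P? ∘ (inside ∷_)) ×-dec allSubsets? (P? ∘ (outside ∷_)))

allTournaments? : {P : Tournament n → Set} → (∀ t → Dec (P t)) → Dec (∀ t → P t)
allTournaments? {zero}  P? = map′ (λ { p [] → p }) (λ f → f []) (P? [])
allTournaments? {suc n} P? =
  map′ (λ { f (r ∷ t) → f r t }) (λ f r t → f (r ∷ t))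
       (allSubsets? λ r → allTournaments? λ t → P? (r ∷ t))

-- Quantifying over Boolean vectors instead of functions makes this decidable by enumeration.
Rigid : Tournament n → Set
Rigid {n} t = (x y : Subset n) → Alternates (digraph t) (lookup x) (lookup y) →
              Steady (digraph t) (lookup x)

rigid? : (t : Tournament n) → Dec (Rigid t)
rigid? t = allSubsets? λ x → allSubsets? λ y →
  alternates? (digraph t) (lookup x) (lookup y) →-dec steady? (digraph t) (lookup x)

-- Matching on the bound makes `n` a numeral, so that each decision evaluates during type checking.
-- The case `n = 4` runs through 64 tournaments with 256 pairs of subsets each.
rigid : n ≤ 4 → (t : Tournament n) → Rigid t
rigid z≤n                         = from-yes (allTournaments? {0} rigid?)
rigid (s≤s z≤n)                   = from-yes (allTournaments? {1} rigid?)
rigid (s≤s (s≤s z≤n))             = from-yes (allTournaments? {2} rigid?)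
rigid (s≤s (s≤s (s≤s z≤n)))       = from-yes (allTournaments? {3} rigid?)
rigid (s≤s (s≤s (s≤s (s≤s z≤n)))) = from-yes (allTournaments? {4} rigid?)

alternates⇒steady : n ≤ 4 → (D : Digraph n) → D IsOrientationOf K n →
                    ∀ x y → Alternates D x y → Steady D x
alternates⇒steady n≤4 D orient x y alt
  with t , t≗D ← orientation⇒tournament _ D orient =
  steady-cong t≗D (lookup∘tabulate x)
    (rigid n≤4 t (tabulate x) (tabulate y)
      (alternates-cong (λ u v → sym (t≗D u v))
        (sym ∘ lookup∘tabulate x) (sym ∘ lookup∘tabulate y) alt))

-- From the game to the constraints.

module _ (D : Digraph n) where

  sent≤chips : ∀ c v → sent D (fires D c) v ≤ c v
  sent≤chips c v with outDeg D v ≤ᵇ c v in eq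
  ... | true  = ≤ᵇ⇒≤ _ _ (subst T (sym eq) _)
  ... | false = z≤n

  -- Having the sent chips on the left removes the truncated subtraction, which is exact by
  -- `sent≤chips`.
  step-conserves : ∀ c v → step D c v + sent D (fires D c) v ≡ c v + received D (fires D c) v
  step-conserves c v = begin
    (c v ∸ s + r) + s ≡⟨ +-assoc (c v ∸ s) r s ⟩
    c v ∸ s + (r + s) ≡⟨ cong (c v ∸ s +_) (+-comm r s) ⟩
    c v ∸ s + (s + r) ≡⟨ +-assoc (c v ∸ s) s r ⟨
    c v ∸ s + s + r   ≡⟨ cong (_+ r) (m∸n+n≡m (sent≤chips c v)) ⟩
    c v + r           ∎
    where
    open ≡-Reasoning
    s = sent D (fires D c) v
    r = received D (fires D c) v

  steady⇒step-fixes : ∀ c → Steady D (fires D c) → step D c ≗ c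
  steady⇒step-fixes c steady v = +-cancelʳ-≡ _ _ _
    (trans (step-conserves c v) (cong (c v +_) (sym (steady v))))

  -- After the step `v` holds at least the chips it has just received, and a vertex that then waits
  -- holds fewer than its out-degree.
  step-restsAfter : ∀ c v → RestsAfter D (fires D c) (fires D (step D c)) v
  step-restsAfter c v _ ¬fires =
    ≤-<-trans (m≤n+m _ _) (≰⇒> (¬fires ∘ ≤⇒≤ᵇ))

  step²-fixes⇒alternates : ∀ c → step D (step D c) ≗ c →
                           Alternates D (fires D c) (fires D (step D c))
  step²-fixes⇒alternates c return v = balance
    , step-restsAfter c v
    -- The round after `step D c` has the chips of `c` again, so `v` fires in it exactly when it
    -- fires in `c`.
    , λ fires¹ ¬fires⁰ → step-restsAfter (step D c) v fires¹
        (¬fires⁰ ∘ subst (T ∘ (outDeg D v ≤ᵇ_)) (return v))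
    where
    open ≡-Reasoning
    s  = sent D (fires D c) v
    s′ = sent D (fires D (step D c)) v
    r  = received D (fires D c) v
    r′ = received D (fires D (step D c)) v

    swap : ∀ a b d → a + b + d ≡ a + d + b
    swap = solve-∀

    balance : s + s′ ≡ r + r′
    balance = +-cancelˡ-≡ (c v) _ _ (begin
      c v + (s + s′)                  ≡⟨ cong (c v +_) (+-comm s s′) ⟩
      c v + (s′ + s)                  ≡⟨ +-assoc (c v) s′ s ⟨
      c v + s′ + s                    ≡⟨ cong (λ d → d + s′ + s) (return v) ⟨
      step D (step D c) v + s′ + s    ≡⟨ cong (_+ s) (step-conserves (step D c) v) ⟩
      step D c v + r′ + s             ≡⟨ swap (step D c v) r′ s ⟩
      step D c v + s + r′             ≡⟨ cong (_+ r′) (step-conserves c v) ⟩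
      c v + r + r′                    ≡⟨ +-assoc (c v) r r′ ⟩
      c v + (r + r′)                  ∎)

lemma3p7 : ∀ (n : ℕ) → n ≥ 1 → n ≤ 4 →
    ∀ (D : Digraph n) → D IsOrientationOf (K n) →
    ∀ (c : Config n) → ¬ (HasPeriod D c 2)
-- The game is constant from `t₀` on, so it also repeats with shift 1, and minimality of 2 would
-- give `2 ≤ 1`, that is `1 < 1`.
lemma3p7 n _ n≤4 D orient c (_ , (t₀ , repeats) , minimal) =
  <-irrefl refl (minimal 1 ≤-refl (t₀ , constant))
  where
  return : ∀ t → t ≥ t₀ → step D (step D (chips D c t)) ≗ chips D c t
  return t t≥t₀ v = sym (trans (repeats t t≥t₀ v)
    (cong (λ s → chips D c s v) (+-comm t 2)))

  constant : ∀ t → t ≥ t₀ → ∀ v → chips D c t v ≡ chips D c (t + 1) v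
  constant t t≥t₀ v = trans
    (sym (steady⇒step-fixes D (chips D c t)
      (alternates⇒steady n≤4 D orient _ _
        (step²-fixes⇒alternates D (chips D c t) (return t t≥t₀))) v))
    (cong (λ s → chips D c s v) (+-comm 1 t))
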